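{- Let $\mathsf{Most}(F,G)$ be the generalized quantifier $|F\cap G|>|F\setminus G|$ and $\mathsf{More\text{ - }than}(F,G,H)$ the generalized quantifier $|F\cap H|>|G\cap H|$ ($F,G,H$ unary). (1) $\mathsf{Most}$ and $\mathsf{More\text{ - }than}$ are bounded $\Delta^1_1$-definable relative to $\Sigma^1_1\text{ - }\mathsf{CA}_0^{\mathsf{fin}}$. (2) $\mathsf{Most}$ and $\mathsf{More\text{ - }than}$ are Henkin domain independent and Henkin conservative relative to $\Sigma^1_1\text{ - }\mathsf{CA}_0^{\mathsf{fin}}$.
   Context: Language: second-order logic with individual variables and, for each $n\ge1$, $n$-ary relation variables, identity, atomic formulas $R\overline x$, and one binary relation symbol $\preceq$ on individuals. The language also contains, as primitive symbols with their usual (first-order definable) meaning, $\emptyset,\subseteq,\cap,\cup,\setminus,\times,X^n$, projections and fields of relations. A formula is first-order if it has no second-order quantifiers; it is $\Sigma^1_1$ (resp. $\Pi^1_1$) if it is a block of existential (resp. universal) second-order quantifiers followed by a first-order formula. Henkin model: $\mathcal A=(A,S_1[A],S_2[A],\ldots;\preceq^{\mathcal A})$ with $A\neq\emptyset$, $\emptyset\neq S_n[A]\subseteq P(A^n)$, $\preceq^{\mathcal A}\subseteq A^2$; $n$-ary relation variables range over $S_n[A]$; $R\overline a$ means $\overline a\in R$. Provability is many-sorted first-order provability, equivalently truth in all Henkin models of the theory. $\mathcal A$ is a substructure of $\mathcal B$ if $A\subseteq B$, $S_n[A]\subseteq S_n[B]$ for all $n$, and $\preceq^{\mathcal B}\cap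 A^2=\preceq^{\mathcal A}$. Cardinality in second-order logic: functions $f:X\to Y$ are identified with their graphs (binary relations contained in $X\times Y$). $|X|\le|Y|$ means there is an injection $f:X\to Y$; $|X|<|Y|$ (equivalently $|Y|>|X|$) means $|X|\le|Y|$ and not $|Y|\le|X|$. $X$ is Dedekind infinite if there is an injective non-surjective $f:X\to X$, and Dedekind finite otherwise. $\Sigma^1_1\text{ - }\mathsf{CA}_0^{\mathsf{fin}}$ consists of: extensionality for each arity; comprehension $\exists R\,\forall\overline x\,(R\overline x\leftrightarrow\varphi(\overline x))$ for all $\Sigma^1_1$ formulas $\varphi$ (which may contain $\preceq$ and parameters; $R$ not free in $\varphi$); axioms saying $\preceq$ is a well-order of the individuals (reflexive, antisymmetric, transitive, linear, and every non-empty unary $X$ has a $\preceq$-least element); and the axiom that the universe $\mathbb V=\{x:x=x\}$ is Dedekind finite. The free variables of each quantifier are split into $\overline R$ and $\overline R'$: for $\mathsf{Most}$, $\overline R=F$ and $\overline R'=G$; for $\mathsf{More\text{ - }than}$, $\overline R=(F,G)$ and $\overline R'=H$. As these are unary, the field $\mathscr U\overline R$ is $F$, respectively $F\cup G$. Binding: for a unary term $X$, $\varphi^X$ restricts each first-order quantifier of $\varphi$ to elements of $X$ and each $n$-ary second-order quantifier to subsets of $X^n$. $Q(\overline R,\overline R')$ is bounded $\Delta^1_1$-definable relative to $T$ if there are a $\Sigma^1_1$ formula $\Phi(\overline R,\overline R')$ and a $\Pi^1_1$ formula $\Psi(\overline R,\overline R')$, with all free variables displayed, such that $T$ proves $\forall\overline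 R\,\forall\overline R'(Q(\overline R,\overline R')\leftrightarrow\Phi^{\mathscr U\overline R}(\overline R,\overline R'))$ and the same with $\Psi$ in place of $\Phi$. $Q$ is Henkin domain independent relative to $T$ if for all Henkin models $\mathcal A,\mathcal B$ of $T$ with $\mathcal A$ a substructure of $\mathcal B$ and all arguments from $\mathcal A$, $\mathcal A\models Q$ iff $\mathcal B\models Q$ at those arguments. $Q$ is Henkin conservative relative to $T$ if $T$ proves $\forall\overline R\,\forall\overline R'(Q(\overline R,\overline R')\leftrightarrow Q(\overline R,\mathscr U\overline R\cap\overline R'))$. -}

module Defs where

open import Data.Empty.Polymorphic using (⊥)
open import Data.Fin using (Fin; _↑ˡ_)
open import Data.Fin.Patterns using (0F; 1F; 2F)
open import Data.List using (List; []; _∷_; _++_)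
open import Data.List.Membership.Propositional using (_∈_)
open import Data.List.Membership.Propositional.Properties using (∈-++⁺ˡ; ∈-++⁺ʳ; ∈-++⁻)
open import Data.List.Relation.Unary.All as All using (All; []; _∷_)
open import Data.List.Relation.Unary.Any using (here; there)
open import Data.Nat using (ℕ; zero; suc; _+_)
open import Data.Product using (_×_; _,_; Σ-syntax; ∃-syntax)
open import Data.Sum using (_⊎_; [_,_]′)
open import Data.Vec as Vec using (Vec; []; _∷_)
open import Data.Vec.Relation.Unary.All as VecAll using ()
open import Function using (_⇔_; Injective)
open import Level using (Level; 0ℓ)
open import Relation.Binary.PropositionalEquality using (_≡_; refl)
open import Relation.Nullary using (¬_)
open import Relation.Unary using (Pred; _≐_)

infixl 8 _^̇_
infixl 7 _∩̇_ _∖̇_ _×̇_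
infixl 6 _∪̇_
infix  5 _⟨_⟩ _≈̇_ _≐̇_ _⊆̇_ _⪯̇_
infix  4 ¬̇_
infixr 3 _∧̇_
infixr 2 _∨̇_
infixr 1 _⇒̇_
infix  0 _⇔̇_

------------------------------------------------------------------------
-- Syntax

-- Relation variables have arity at least one: the entry k of a context
-- declares a variable of arity suc k.  De Bruijn indices throughout.

Context : Set
Context = List ℕ

pattern unary  = 0
pattern binary = 1

-- RTerm Γ m: relation terms of (true) arity m.

data RTerm (Γ : Context) : ℕ → Set where
  var   : ∀ {k} → k ∈ Γ → RTerm Γ (suc k)
  ∅̇     : ∀ {k} → RTerm Γ (suc k)
  _∩̇_   : ∀ {m} → RTerm Γ m → RTerm Γ m → RTerm Γ m
  _∪̇_   : ∀ {m} → RTerm Γ m → RTerm Γ m → RTerm Γ m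
  _∖̇_   : ∀ {m} → RTerm Γ m → RTerm Γ m → RTerm Γ m
  _×̇_   : ∀ {m n} → RTerm Γ m → RTerm Γ n → RTerm Γ (m + n)
  _^̇_   : RTerm Γ 1 → ∀ m → RTerm Γ (suc m)  -- X ^̇ m is the Cartesian power with suc m factors
  proj  : ∀ {m} → Fin m → RTerm Γ m → RTerm Γ 1
  fld   : ∀ {m} → RTerm Γ m → RTerm Γ 1      -- the union of all projections

-- Formula Γ n: relation variables from Γ, n individual variables.

data Formula (Γ : Context) (n : ℕ) : Set where
  _⟨_⟩ : ∀ {m} → RTerm Γ m → Vec (Fin n) m → Formula Γ n
  _≈̇_  : Fin n → Fin n → Formula Γ n
  _≐̇_  : ∀ {m} → RTerm Γ m → RTerm Γ m → Formula Γ n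
  _⊆̇_  : ∀ {m} → RTerm Γ m → RTerm Γ m → Formula Γ n
  _⪯̇_  : Fin n → Fin n → Formula Γ n
  ¬̇_   : Formula Γ n → Formula Γ n
  _∧̇_  : Formula Γ n → Formula Γ n → Formula Γ n
  _∨̇_  : Formula Γ n → Formula Γ n → Formula Γ n
  _⇒̇_  : Formula Γ n → Formula Γ n → Formula Γ n
  ∀¹   : Formula Γ (suc n) → Formula Γ n
  ∃¹   : Formula Γ (suc n) → Formula Γ n
  ∀²   : ∀ k → Formula (k ∷ Γ) n → Formula Γ n
  ∃²   : ∀ k → Formula (k ∷ Γ) n → Formula Γ n

Sentence : Set
Sentence = Formula [] 0

_⇔̇_ : ∀ {Γ n} → Formula Γ n → Formula Γ n → Formula Γ n
φ ⇔̇ ψ = (φ ⇒̇ ψ) ∧̇ (ψ ⇒̇ φ)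

data FirstOrder {Γ : Context} : ∀ {n} → Formula Γ n → Set where
  rel : ∀ {n m} (R : RTerm Γ m) (xs : Vec (Fin n) m) → FirstOrder (R ⟨ xs ⟩)
  eq₁ : ∀ {n} (x y : Fin n) → FirstOrder (x ≈̇ y)
  eq₂ : ∀ {n m} (R S : RTerm Γ m) → FirstOrder {n = n} (R ≐̇ S)
  sub : ∀ {n m} (R S : RTerm Γ m) → FirstOrder {n = n} (R ⊆̇ S)
  ord : ∀ {n} (x y : Fin n) → FirstOrder (x ⪯̇ y)
  neg : ∀ {n} {φ : Formula Γ n} → FirstOrder φ → FirstOrder (¬̇ φ)
  and : ∀ {n} {φ ψ : Formula Γ n} → FirstOrder φ → FirstOrder ψ → FirstOrder (φ ∧̇ ψ)
  or  : ∀ {n} {φ ψ : Formula Γ n} → FirstOrder φ → FirstOrder ψ → FirstOrder (φ ∨̇ ψ)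
  imp : ∀ {n} {φ ψ : Formula Γ n} → FirstOrder φ → FirstOrder ψ → FirstOrder (φ ⇒̇ ψ)
  all : ∀ {n} {φ : Formula Γ (suc n)} → FirstOrder φ → FirstOrder (∀¹ φ)
  ex  : ∀ {n} {φ : Formula Γ (suc n)} → FirstOrder φ → FirstOrder (∃¹ φ)

data IsΣ¹₁ {n : ℕ} : ∀ {Γ} → Formula Γ n → Set where
  matrix : ∀ {Γ} {φ : Formula Γ n} → FirstOrder φ → IsΣ¹₁ φ
  ex²    : ∀ {Γ k} {φ : Formula (k ∷ Γ) n} → IsΣ¹₁ φ → IsΣ¹₁ (∃² k φ)

data IsΠ¹₁ {n : ℕ} : ∀ {Γ} → Formula Γ n → Set where
  matrix : ∀ {Γ} {φ : Formula Γ n} → FirstOrder φ → IsΠ¹₁ φ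
  all²   : ∀ {Γ k} {φ : Formula (k ∷ Γ) n} → IsΠ¹₁ φ → IsΠ¹₁ (∀² k φ)

-- Substitution of relation terms for relation variables.

renameᵗ : ∀ {Γ Δ m} → (∀ {k} → k ∈ Γ → k ∈ Δ) → RTerm Γ m → RTerm Δ m
renameᵗ r (var X)    = var (r X)
renameᵗ r ∅̇          = ∅̇
renameᵗ r (R ∩̇ S)    = renameᵗ r R ∩̇ renameᵗ r S
renameᵗ r (R ∪̇ S)    = renameᵗ r R ∪̇ renameᵗ r S
renameᵗ r (R ∖̇ S)    = renameᵗ r R ∖̇ renameᵗ r S
renameᵗ r (R ×̇ S)    = renameᵗ r R ×̇ renameᵗ r S
renameᵗ r (X ^̇ m)    = renameᵗ r X ^̇ m
renameᵗ r (proj i R) = proj i (renameᵗ r R)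
renameᵗ r (fld R)    = fld (renameᵗ r R)

weakenᵗ : ∀ {Γ k m} → RTerm Γ m → RTerm (k ∷ Γ) m
weakenᵗ = renameᵗ there

Subst : Context → Context → Set
Subst Γ Δ = ∀ {k} → k ∈ Γ → RTerm Δ (suc k)

lift : ∀ {Γ Δ k} → Subst Γ Δ → Subst (k ∷ Γ) (k ∷ Δ)
lift σ (here e)  = var (here e)
lift σ (there X) = weakenᵗ (σ X)

substᵗ : ∀ {Γ Δ m} → Subst Γ Δ → RTerm Γ m → RTerm Δ m
substᵗ σ (var X)    = σ X
substᵗ σ ∅̇          = ∅̇
substᵗ σ (R ∩̇ S)    = substᵗ σ R ∩̇ substᵗ σ S
substᵗ σ (R ∪̇ S)    = substᵗ σ R ∪̇ substᵗ σ S
substᵗ σ (R ∖̇ S)    = substᵗ σ R ∖̇ substᵗ σ S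
substᵗ σ (R ×̇ S)    = substᵗ σ R ×̇ substᵗ σ S
substᵗ σ (X ^̇ m)    = substᵗ σ X ^̇ m
substᵗ σ (proj i R) = proj i (substᵗ σ R)
substᵗ σ (fld R)    = fld (substᵗ σ R)

substᶠ : ∀ {Γ Δ n} → Subst Γ Δ → Formula Γ n → Formula Δ n
substᶠ σ (R ⟨ xs ⟩) = substᵗ σ R ⟨ xs ⟩
substᶠ σ (x ≈̇ y)    = x ≈̇ y
substᶠ σ (R ≐̇ S)    = substᵗ σ R ≐̇ substᵗ σ S
substᶠ σ (R ⊆̇ S)    = substᵗ σ R ⊆̇ substᵗ σ S
substᶠ σ (x ⪯̇ y)    = x ⪯̇ y
substᶠ σ (¬̇ φ)      = ¬̇ substᶠ σ φ
substᶠ σ (φ ∧̇ ψ)    = substᶠ σ φ ∧̇ substᶠ σ ψ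
substᶠ σ (φ ∨̇ ψ)    = substᶠ σ φ ∨̇ substᶠ σ ψ
substᶠ σ (φ ⇒̇ ψ)    = substᶠ σ φ ⇒̇ substᶠ σ ψ
substᶠ σ (∀¹ φ)     = ∀¹ (substᶠ σ φ)
substᶠ σ (∃¹ φ)     = ∃¹ (substᶠ σ φ)
substᶠ σ (∀² k φ)   = ∀² k (substᶠ (lift σ) φ)
substᶠ σ (∃² k φ)   = ∃² k (substᶠ (lift σ) φ)

weakenᶠ : ∀ {Γ k n} → Formula Γ n → Formula (k ∷ Γ) n
weakenᶠ = substᶠ (λ X → var (there X))

-- bound X φ is φ^X.  The primitive relation symbols are left as they are.

bound : ∀ {Γ n} → RTerm Γ 1 → Formula Γ n → Formula Γ n
bound X (R ⟨ xs ⟩) = R ⟨ xs ⟩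
bound X (x ≈̇ y)    = x ≈̇ y
bound X (R ≐̇ S)    = R ≐̇ S
bound X (R ⊆̇ S)    = R ⊆̇ S
bound X (x ⪯̇ y)    = x ⪯̇ y
bound X (¬̇ φ)      = ¬̇ bound X φ
bound X (φ ∧̇ ψ)    = bound X φ ∧̇ bound X ψ
bound X (φ ∨̇ ψ)    = bound X φ ∨̇ bound X ψ
bound X (φ ⇒̇ ψ)    = bound X φ ⇒̇ bound X ψ
bound X (∀¹ φ)     = ∀¹ (X ⟨ 0F ∷ [] ⟩ ⇒̇ bound X φ)
bound X (∃¹ φ)     = ∃¹ (X ⟨ 0F ∷ [] ⟩ ∧̇ bound X φ)
bound X (∀² k φ)   = ∀² k (var (here refl) ⊆̇ weakenᵗ X ^̇ k ⇒̇ bound (weakenᵗ X) φ)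
bound X (∃² k φ)   = ∃² k (var (here refl) ⊆̇ weakenᵗ X ^̇ k ∧̇ bound (weakenᵗ X) φ)

∀¹* : ∀ {Γ n} m → Formula Γ (m + n) → Formula Γ n
∀¹* zero    φ = φ
∀¹* (suc m) φ = ∀¹* m (∀¹ φ)

close¹ : ∀ {Γ} n → Formula Γ n → Formula Γ 0
close¹ zero    φ = φ
close¹ (suc n) φ = close¹ n (∀¹ φ)

close² : ∀ Γ → Formula Γ 0 → Sentence
close² []      φ = φ
close² (k ∷ Γ) φ = close² Γ (∀² k φ)

close : ∀ {Γ n} → Formula Γ n → Sentence
close {Γ} {n} φ = close² Γ (close¹ n φ)

------------------------------------------------------------------------
-- Cardinality

module _ {Γ : Context} {n : ℕ} where

  IsFunction : RTerm Γ 2 → RTerm Γ 1 → RTerm Γ 1 → Formula Γ n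
  IsFunction f X Y =
      f ⊆̇ X ×̇ Y
    ∧̇ ∀¹ (X ⟨ 0F ∷ [] ⟩ ⇒̇ ∃¹ (f ⟨ 1F ∷ 0F ∷ [] ⟩))
    ∧̇ ∀¹ (∀¹ (∀¹ (f ⟨ 2F ∷ 1F ∷ [] ⟩ ∧̇ f ⟨ 2F ∷ 0F ∷ [] ⟩ ⇒̇ 1F ≈̇ 0F)))

  IsInjection : RTerm Γ 2 → RTerm Γ 1 → RTerm Γ 1 → Formula Γ n
  IsInjection f X Y =
      IsFunction f X Y
    ∧̇ ∀¹ (∀¹ (∀¹ (f ⟨ 2F ∷ 0F ∷ [] ⟩ ∧̇ f ⟨ 1F ∷ 0F ∷ [] ⟩ ⇒̇ 2F ≈̇ 1F)))

  IsOnto : RTerm Γ 2 → RTerm Γ 1 → Formula Γ n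
  IsOnto f Y = ∀¹ (Y ⟨ 0F ∷ [] ⟩ ⇒̇ ∃¹ (f ⟨ 0F ∷ 1F ∷ [] ⟩))

module _ {Γ : Context} {n : ℕ} where

  infix 5 _≤ᶜ_ _<ᶜ_ _>ᶜ_

  _≤ᶜ_ _<ᶜ_ _>ᶜ_ : RTerm Γ 1 → RTerm Γ 1 → Formula Γ n
  X ≤ᶜ Y = ∃² binary (IsInjection (var (here refl)) (weakenᵗ X) (weakenᵗ Y))
  X <ᶜ Y = X ≤ᶜ Y ∧̇ ¬̇ Y ≤ᶜ X
  X >ᶜ Y = Y <ᶜ X

  DedekindInfinite DedekindFinite : RTerm Γ 1 → Formula Γ n
  DedekindInfinite X =
    ∃² binary ( IsInjection (var (here refl)) (weakenᵗ X) (weakenᵗ X)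
              ∧̇ ¬̇ IsOnto (var (here refl)) (weakenᵗ X))
  DedekindFinite X = ¬̇ DedekindInfinite X

------------------------------------------------------------------------
-- The theory

Theory : Set₁
Theory = Pred Sentence 0ℓ

-- x̄ = (x₀ , … , x_k), followed by n individual parameters
firstVars : ∀ k n → Vec (Fin (suc k + n)) (suc k)
firstVars k n = Vec.tabulate (_↑ˡ n)

R₀ : ∀ {Γ k} → RTerm (k ∷ Γ) (suc k)
R₀ = var (here refl)

R₁ : ∀ {Γ j k} → RTerm (j ∷ k ∷ Γ) (suc k)
R₁ = var (there (here refl))

R₂ : ∀ {Γ i j k} → RTerm (i ∷ j ∷ k ∷ Γ) (suc k)
R₂ = var (there (there (here refl)))

data Σ¹₁-CA₀ᶠⁱⁿ : Theory where

  extensionality : ∀ k → Σ¹₁-CA₀ᶠⁱⁿ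
    (∀² k (∀² k (∀¹* (suc k) (R₁ ⟨ firstVars k 0 ⟩ ⇔̇ R₀ ⟨ firstVars k 0 ⟩) ⇒̇ R₁ ≐̇ R₀)))

  -- Γ and n are the parameters of φ; weakening makes R not free in φ.
  comprehension : ∀ {Γ k n} (φ : Formula Γ (suc k + n)) → IsΣ¹₁ φ → Σ¹₁-CA₀ᶠⁱⁿ
    (close (∃² k (∀¹* {n = n} (suc k) (R₀ ⟨ firstVars k n ⟩ ⇔̇ weakenᶠ φ))))

  ⪯-reflexive : Σ¹₁-CA₀ᶠⁱⁿ
    (∀¹ (0F ⪯̇ 0F))

  ⪯-antisymmetric : Σ¹₁-CA₀ᶠⁱⁿ
    (∀¹ (∀¹ (1F ⪯̇ 0F ∧̇ 0F ⪯̇ 1F ⇒̇ 1F ≈̇ 0F)))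

  ⪯-transitive : Σ¹₁-CA₀ᶠⁱⁿ
    (∀¹ (∀¹ (∀¹ (2F ⪯̇ 1F ∧̇ 1F ⪯̇ 0F ⇒̇ 2F ⪯̇ 0F))))

  ⪯-linear : Σ¹₁-CA₀ᶠⁱⁿ
    (∀¹ (∀¹ (1F ⪯̇ 0F ∨̇ 0F ⪯̇ 1F)))

  ⪯-wellFounded : Σ¹₁-CA₀ᶠⁱⁿ
    (∀² unary ( ∃¹ (R₀ ⟨ 0F ∷ [] ⟩)
              ⇒̇ ∃¹ (R₀ ⟨ 0F ∷ [] ⟩ ∧̇ ∀¹ (R₀ ⟨ 0F ∷ [] ⟩ ⇒̇ 1F ⪯̇ 0F))))

  𝕍-finite : Σ¹₁-CA₀ᶠⁱⁿ
    (∃² unary (∀¹ (R₀ ⟨ 0F ∷ [] ⟩ ⇔̇ 0F ≈̇ 0F) ∧̇ DedekindFinite R₀))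

------------------------------------------------------------------------
-- Henkin models

-- Rel k presents the family S_{k+1}[A] of subsets of A^{k+1}: the members
-- of the family are the sets ext R, so R and S name the same member when
-- ext R and ext S have the same elements.

record HenkinModel (ℓ : Level) : Set (Level.suc ℓ) where
  infix 4 _⪯_
  field
    Carrier      : Set ℓ
    nonempty     : Carrier
    Rel          : ℕ → Set ℓ
    Rel-nonempty : ∀ k → Rel k
    ext          : ∀ {k} → Rel k → Pred (Vec Carrier (suc k)) ℓ
    _⪯_          : Carrier → Carrier → Set ℓ

module _ {ℓ : Level} (𝒜 : HenkinModel ℓ) where
  open HenkinModel 𝒜

  ⟦_⟧ : ∀ {Γ m} → RTerm Γ m → All Rel Γ → Pred (Vec Carrier m) ℓ
  ⟦ var X ⟧    ρ as = ext (All.lookup ρ X) as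
  ⟦ ∅̇ ⟧        ρ as = ⊥
  ⟦ R ∩̇ S ⟧    ρ as = ⟦ R ⟧ ρ as × ⟦ S ⟧ ρ as
  ⟦ R ∪̇ S ⟧    ρ as = ⟦ R ⟧ ρ as ⊎ ⟦ S ⟧ ρ as
  ⟦ R ∖̇ S ⟧    ρ as = ⟦ R ⟧ ρ as × ¬ ⟦ S ⟧ ρ as
  ⟦ _×̇_ {m} R S ⟧ ρ as = ⟦ R ⟧ ρ (Vec.take m as) × ⟦ S ⟧ ρ (Vec.drop m as)
  ⟦ X ^̇ m ⟧    ρ as = VecAll.All (λ a → ⟦ X ⟧ ρ (a ∷ [])) as
  ⟦ proj i R ⟧ ρ as = ∃[ bs ] ⟦ R ⟧ ρ bs × Vec.lookup bs i ≡ Vec.head as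
  ⟦ fld R ⟧    ρ as = ∃[ i ] ∃[ bs ] ⟦ R ⟧ ρ bs × Vec.lookup bs i ≡ Vec.head as

  Sat : ∀ {Γ n} → Formula Γ n → All Rel Γ → Vec Carrier n → Set ℓ
  Sat (R ⟨ xs ⟩) ρ v = ⟦ R ⟧ ρ (Vec.map (Vec.lookup v) xs)
  Sat (x ≈̇ y)    ρ v = Vec.lookup v x ≡ Vec.lookup v y
  Sat (R ≐̇ S)    ρ v = ∀ as → ⟦ R ⟧ ρ as ⇔ ⟦ S ⟧ ρ as
  Sat (R ⊆̇ S)    ρ v = ∀ as → ⟦ R ⟧ ρ as → ⟦ S ⟧ ρ as
  Sat (x ⪯̇ y)    ρ v = Vec.lookup v x ⪯ Vec.lookup v y
  Sat (¬̇ φ)      ρ v = ¬ Sat φ ρ v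
  Sat (φ ∧̇ ψ)    ρ v = Sat φ ρ v × Sat ψ ρ v
  Sat (φ ∨̇ ψ)    ρ v = Sat φ ρ v ⊎ Sat ψ ρ v
  Sat (φ ⇒̇ ψ)    ρ v = Sat φ ρ v → Sat ψ ρ v
  Sat (∀¹ φ)     ρ v = ∀ a → Sat φ ρ (a ∷ v)
  Sat (∃¹ φ)     ρ v = ∃[ a ] Sat φ ρ (a ∷ v)
  Sat (∀² k φ)   ρ v = ∀ (R : Rel k) → Sat φ (R ∷ ρ) v
  Sat (∃² k φ)   ρ v = Σ[ R ∈ Rel k ] Sat φ (R ∷ ρ) v

  IsModelOf : Theory → Set ℓ
  IsModelOf T = ∀ {φ} → T φ → Sat φ [] []

-- The field of a unary relation is the relation itself.

fld-unary : ∀ {ℓ} (𝒜 : HenkinModel ℓ) {Γ} (R : RTerm Γ 1) ρ →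
              ⟦_⟧ 𝒜 (fld R) ρ ≐ ⟦_⟧ 𝒜 R ρ
fld-unary 𝒜 R ρ =
    (λ { {a ∷ []} (0F , (b ∷ []) , Rb , refl) → Rb })
  , (λ { {a ∷ []} Ra → 0F , (a ∷ []) , Ra , refl })

-- Provability, as truth in all Henkin models of the theory.

Proves : (ℓ : Level) → Theory → Sentence → Set (Level.suc ℓ)
Proves ℓ T φ = (𝒜 : HenkinModel ℓ) → IsModelOf 𝒜 T → Sat 𝒜 φ [] []

-- 𝒜 ⊆ ℬ, with the inclusion of carriers given as an injection ι and the
-- inclusion S_n[A] ⊆ S_n[B] as the requirement that the ι-image of every
-- relation of 𝒜 is a relation of ℬ.

record Substructure {ℓ} (𝒜 ℬ : HenkinModel ℓ) : Set ℓ where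
  private
    module A = HenkinModel 𝒜
    module B = HenkinModel ℬ
  field
    ι           : A.Carrier → B.Carrier
    ι-injective : Injective _≡_ _≡_ ι
    incl        : ∀ {k} → A.Rel k → B.Rel k
    ext-incl    : ∀ {k} (R : A.Rel k) →
                  B.ext (incl R) ≐ (λ bs → ∃[ as ] A.ext R as × Vec.map ι as ≡ bs)
    ⪯-restrict  : ∀ a a′ → (ι a B.⪯ ι a′) ⇔ (a A.⪯ a′)

------------------------------------------------------------------------
-- Generalized quantifiers

-- The quantifier Q(R̄, R̄′), with R̄ declared by Γ and R̄′ by Γ′.

GQ : Context → Context → Set
GQ Γ Γ′ = Formula (Γ ++ Γ′) 0

unionOfFields : ∀ {Γ Δ} → All (_∈ Δ) Γ → RTerm Δ 1
unionOfFields []           = ∅̇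
unionOfFields (X ∷ [])     = fld (var X)
unionOfFields (X ∷ Y ∷ Xs) = fld (var X) ∪̇ unionOfFields (Y ∷ Xs)

𝒰 : ∀ Γ Γ′ → RTerm (Γ ++ Γ′) 1
𝒰 Γ Γ′ = unionOfFields {Γ} (All.tabulate ∈-++⁺ˡ)

record BoundedΔ¹₁Definable (ℓ : Level) (T : Theory) (Γ Γ′ : Context)
                           (Q : GQ Γ Γ′) : Set (Level.suc ℓ) where
  field
    Φ Ψ      : Formula (Γ ++ Γ′) 0
    Φ-Σ¹₁    : IsΣ¹₁ Φ
    Ψ-Π¹₁    : IsΠ¹₁ Ψ
    Φ-defines : Proves ℓ T (close (Q ⇔̇ bound (𝒰 Γ Γ′) Φ))
    Ψ-defines : Proves ℓ T (close (Q ⇔̇ bound (𝒰 Γ Γ′) Ψ))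

HenkinDomainIndependent : (ℓ : Level) → Theory → ∀ Γ Γ′ → GQ Γ Γ′ → Set (Level.suc ℓ)
HenkinDomainIndependent ℓ T Γ Γ′ Q =
  (𝒜 ℬ : HenkinModel ℓ) → IsModelOf 𝒜 T → IsModelOf ℬ T →
  (s : Substructure 𝒜 ℬ) (R̄ : All (HenkinModel.Rel 𝒜) (Γ ++ Γ′)) →
  Sat 𝒜 Q R̄ [] ⇔ Sat ℬ Q (All.map (Substructure.incl s) R̄) []

-- R̄ ↦ R̄ and R̄′ ↦ 𝒰R̄ ∩ R̄′, an n-ary member of R̄′ being cut down to (𝒰R̄)ⁿ.

cutDown : ∀ Γ Γ′ → Subst (Γ ++ Γ′) (Γ ++ Γ′)
cutDown Γ Γ′ {k} X =
  [ (λ Y → var (∈-++⁺ˡ Y))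
  , (λ Y → 𝒰 Γ Γ′ ^̇ k ∩̇ var (∈-++⁺ʳ Γ Y))
  ]′ (∈-++⁻ Γ X)

HenkinConservative : (ℓ : Level) → Theory → ∀ Γ Γ′ → GQ Γ Γ′ → Set (Level.suc ℓ)
HenkinConservative ℓ T Γ Γ′ Q = Proves ℓ T (close (Q ⇔̇ substᶠ (cutDown Γ Γ′) Q))

-- Q = Most: R̄ = F and R̄′ = G.

Most : GQ (unary ∷ []) (unary ∷ [])
Most = F ∩̇ G >ᶜ F ∖̇ G
  where
  F = R₀
  G = R₁

-- R̄ = (F , G) and R̄′ = H.

More-than : GQ (unary ∷ unary ∷ []) (unary ∷ [])
More-than = F ∩̇ H >ᶜ G ∩̇ H
  where
  F = R₀
  G = R₁
  H = R₂

{-# OPTIONS --safe #-}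
-- In a Dedekind finite universe X ≺ Y can be expressed in two ways.  It is
-- Σ¹₁: some injection X → Y is not onto, since composing it with an injection
-- Y → X would give a self-injection of Y that is not onto, which extends by the
-- identity to the universe.  It is Π¹₁: there is no injection Y → X, since any
-- two sets are comparable.  For comparability, every non-empty set has a
-- ⪯-maximum, so an injection of an initial segment of X into Y can be extended
-- one point at a time.  All these injections live on X ∪ Y, which gives the
-- bounds, and both an injection that is not onto and the injection Y → X that
-- witnesses the failure of X ≺ Y persist from a model to a larger one.

module Submission where

open import Defs
open import Axiom.ExcludedMiddle using (ExcludedMiddle)
open import Data.Bool using (T)
open import Data.Fin using (_↑ˡ_)
open import Data.Fin.Patterns using (0F; 1F; 2F; 3F)
open import Data.List using ([]; _∷_)
open import Data.List.Relation.Unary.All using (All; []; _∷_)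
open import Data.Maybe as Maybe using (Maybe; just; nothing; is-just; to-witness-T)
open import Data.Nat using (zero; suc; _+_)
open import Data.Product using (_×_; _,_; proj₁; proj₂; ∃-syntax; -,_)
open import Data.Sum using (_⊎_; inj₁; inj₂)
open import Data.Vec as Vec using (Vec; []; _∷_)
open import Data.Vec.Properties using (lookup-++ˡ; tabulate-cong; tabulate-∘; tabulate∘lookup; ∷-injective)
open import Data.Vec.Relation.Unary.All as VecAll using ([]; _∷_)
open import Function using (id; _⇔_; mk⇔; Injective)
open import Relation.Binary.PropositionalEquality using (_≡_; _≢_; refl; sym; trans; cong; cong₂; subst)
open import Relation.Nullary using (¬_; yes; no; contradiction)
open import Relation.Nullary.Decidable using (decidable-stable)
open import Relation.Unary using (Pred; _≐_; _∩_; _∪_; _∖_; _⊆_)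
open import Relation.Unary.Properties using (≐-sym)

-- Recognizing first-order and Σ¹₁ formulas

firstOrder? : ∀ {Γ n} (φ : Formula Γ n) → Maybe (FirstOrder φ)
firstOrder? (R ⟨ xs ⟩) = just (rel R xs)
firstOrder? (x ≈̇ y)    = just (eq₁ x y)
firstOrder? (R ≐̇ S)    = just (eq₂ R S)
firstOrder? (R ⊆̇ S)    = just (sub R S)
firstOrder? (x ⪯̇ y)    = just (ord x y)
firstOrder? (¬̇ φ)      = Maybe.map neg (firstOrder? φ)
firstOrder? (φ ∧̇ ψ)    = Maybe.zipWith and (firstOrder? φ) (firstOrder? ψ)
firstOrder? (φ ∨̇ ψ)    = Maybe.zipWith or (firstOrder? φ) (firstOrder? ψ)
firstOrder? (φ ⇒̇ ψ)    = Maybe.zipWith imp (firstOrder? φ) (firstOrder? ψ)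
firstOrder? (∀¹ φ)     = Maybe.map all (firstOrder? φ)
firstOrder? (∃¹ φ)     = Maybe.map ex (firstOrder? φ)
firstOrder? (∀² k φ)   = nothing
firstOrder? (∃² k φ)   = nothing

-- On a concrete Σ¹₁ formula this evaluates to `just`, so complexity side conditions are settled by
-- computation and `to-witness-T` extracts the derivation.
Σ¹₁? : ∀ {Γ n} (φ : Formula Γ n) → Maybe (IsΣ¹₁ φ)
Σ¹₁? (∃² k φ) = Maybe.map ex² (Σ¹₁? φ)
Σ¹₁? φ        = Maybe.map matrix (firstOrder? φ)

infix 5 _<̇_

_<̇_ : ∀ {Γ n} → _ → _ → Formula Γ n
x <̇ y = x ⪯̇ y ∧̇ ¬̇ (x ≈̇ y)

-- Instantiating universal closures

module Closures {ℓ} (𝒜 : HenkinModel ℓ) where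
  open HenkinModel 𝒜

  close²-elim : ∀ Γ (φ : Formula Γ 0) → Sat 𝒜 (close² Γ φ) [] [] → ∀ ρ → Sat 𝒜 φ ρ []
  close²-elim []      φ s []      = s
  close²-elim (k ∷ Γ) φ s (R ∷ ρ) = close²-elim Γ (∀² k φ) s ρ R

  close¹-elim : ∀ {Γ} n (φ : Formula Γ n) {ρ} → Sat 𝒜 (close¹ n φ) ρ [] → ∀ v → Sat 𝒜 φ ρ v
  close¹-elim zero    φ s []      = s
  close¹-elim (suc n) φ s (a ∷ v) = close¹-elim n (∀¹ φ) s v a

  close-elim : ∀ {Γ n} (φ : Formula Γ n) → Sat 𝒜 (close φ) [] [] → ∀ ρ v → Sat 𝒜 φ ρ v
  close-elim {Γ} {n} φ s ρ = close¹-elim n φ (close²-elim Γ (close¹ n φ) s ρ)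

  ∀¹*-elim : ∀ {Γ n} m {φ : Formula Γ (m + n)} {ρ v} →
             Sat 𝒜 (∀¹* m φ) ρ v → ∀ as → Sat 𝒜 φ ρ (as Vec.++ v)
  ∀¹*-elim zero    s []       = s
  ∀¹*-elim (suc m) {φ} s (a ∷ as) = ∀¹*-elim m {∀¹ φ} s as a

  -- Hence, under `as Vec.++ v`, the atom in a comprehension axiom says that the tuple `as` itself
  -- belongs to the comprehended relation.
  lookup-firstVars : ∀ k {n} (as : Vec Carrier (suc k)) (v : Vec Carrier n) →
                     Vec.map (Vec.lookup (as Vec.++ v)) (firstVars k n) ≡ as
  lookup-firstVars k {n} as v =
    trans (sym (tabulate-∘ (Vec.lookup (as Vec.++ v)) (_↑ˡ n)))
          (trans (tabulate-cong (lookup-++ˡ as v)) (tabulate∘lookup as))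

-- Injections in a Henkin model and their bounded forms

module Injections {ℓ} (𝒜 : HenkinModel ℓ) where
  open HenkinModel 𝒜

  infix 4 _∋_ _[_,_] _≼_ _≺_

  _∋_ : Pred (Vec Carrier 1) ℓ → Carrier → Set ℓ
  X ∋ a = X (a ∷ [])

  _[_,_] : Rel 1 → Carrier → Carrier → Set ℓ
  f [ a , b ] = ext f (a ∷ b ∷ [])

  -- Each of these unfolds to the satisfaction of the corresponding clause of
  -- IsInjection and IsOnto, with the domain of totality D split off from X.

  Within : Rel 1 → (X Y : Pred (Vec Carrier 1) ℓ) → Set ℓ
  Within f X Y = ∀ as → ext f as → X (Vec.take 1 as) × Y (Vec.drop 1 as)

  Total Onto : Rel 1 → Pred (Vec Carrier 1) ℓ → Set ℓ
  Total f D = ∀ a → D ∋ a → ∃[ b ] f [ a , b ]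
  Onto f Y  = ∀ b → Y ∋ b → ∃[ a ] f [ a , b ]

  PartialInj : Rel 1 → (D X Y : Pred (Vec Carrier 1) ℓ) → Set ℓ
  PartialInj f D X Y =
      (Within f X Y × Total f D × (∀ a b c → f [ a , b ] × f [ a , c ] → b ≡ c))
    × (∀ a b c → f [ a , c ] × f [ b , c ] → a ≡ b)

  Inj : Rel 1 → (X Y : Pred (Vec Carrier 1) ℓ) → Set ℓ
  Inj f X Y = PartialInj f X X Y

  _≼_ _≺_ ProperInj : (X Y : Pred (Vec Carrier 1) ℓ) → Set ℓ
  X ≼ Y = ∃[ f ] Inj f X Y
  X ≺ Y = X ≼ Y × ¬ Y ≼ X
  ProperInj X Y = ∃[ f ] Inj f X Y × ¬ Onto f Y

  -- Relation terms denote mere predicates, whereas the relation parameters of comprehension are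
  -- members of `Rel`. This singles out the predicates that can serve as such parameters.
  Definable : Pred (Vec Carrier 1) ℓ → Set ℓ
  Definable X = ∃[ R ] ext {0} R ≐ X

  PartialInj-mono : ∀ {f D D′ X X′ Y Y′} → D′ ⊆ D → X ⊆ X′ → Y ⊆ Y′ →
                    PartialInj f D X Y → PartialInj f D′ X′ Y′
  PartialInj-mono D′⊆D X⊆X′ Y⊆Y′ ((within , total , functional) , injective) =
    ( (λ as fas → let x , y = within as fas in X⊆X′ x , Y⊆Y′ y)
    , (λ a d → total a (D′⊆D d))
    , functional ) , injective

  ≼-cong : ∀ {X X′ Y Y′} → X ≐ X′ → Y ≐ Y′ → X ≼ Y → X′ ≼ Y′
  ≼-cong {X} {X′} {Y} {Y′} (X⊆X′ , X′⊆X) (Y⊆Y′ , _) (f , inj) =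
    f , PartialInj-mono {f} {X} {X′} {X} {X′} {Y} {Y′} X′⊆X X⊆X′ Y⊆Y′ inj

  ≺-cong : ∀ {X X′ Y Y′} → X ≐ X′ → Y ≐ Y′ → X ≺ Y → X′ ≺ Y′
  ≺-cong {X} {X′} {Y} {Y′} X≐X′ Y≐Y′ (X≼Y , Y⋠X) =
    ≼-cong {X} {X′} {Y} {Y′} X≐X′ Y≐Y′ X≼Y ,
    λ Y′≼X′ → Y⋠X (≼-cong {Y′} {Y} {X′} {X} (≐-sym Y≐Y′) (≐-sym X≐X′) Y′≼X′)

  -- The relativized counterparts unfold to the satisfaction of the same
  -- clauses after applying bound.

  Power : Pred (Vec Carrier 1) ℓ → ∀ {n} → Pred (Vec Carrier n) ℓ
  Power U = VecAll.All (U ∋_)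

  InjIn : Pred (Vec Carrier 1) ℓ → Rel 1 → (X Y : Pred (Vec Carrier 1) ℓ) → Set ℓ
  InjIn U f X Y =
      ( Within f X Y
      × (∀ a → U ∋ a → X ∋ a → ∃[ b ] U ∋ b × f [ a , b ])
      × (∀ a → U ∋ a → ∀ b → U ∋ b → ∀ c → U ∋ c → f [ a , b ] × f [ a , c ] → b ≡ c) )
    × (∀ a → U ∋ a → ∀ b → U ∋ b → ∀ c → U ∋ c → f [ a , c ] × f [ b , c ] → a ≡ b)

  OntoIn : Pred (Vec Carrier 1) ℓ → Rel 1 → Pred (Vec Carrier 1) ℓ → Set ℓ
  OntoIn U f Y = ∀ b → U ∋ b → Y ∋ b → ∃[ a ] U ∋ a × f [ a , b ]

  ProperInjIn NoInjIn : (U X Y : Pred (Vec Carrier 1) ℓ) → Set ℓ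
  ProperInjIn U X Y = ∃[ f ] (∀ as → ext f as → Power U as) × InjIn U f X Y × ¬ OntoIn U f Y
  NoInjIn U X Y     = ∀ f → (∀ as → ext f as → Power U as) → ¬ InjIn U f X Y

  module _ {U X Y : Pred (Vec Carrier 1) ℓ} (X⊆U : X ⊆ U) (Y⊆U : Y ⊆ U) where

    Within⇒Power : ∀ {f} → Within f X Y → ∀ as → ext f as → Power U as
    Within⇒Power within (a ∷ b ∷ []) fab = let x , y = within _ fab in X⊆U x ∷ Y⊆U y ∷ []

    Inj⇒InjIn : ∀ {f} → Inj f X Y → InjIn U f X Y
    Inj⇒InjIn ((within , total , functional) , injective) =
      ( within
      , (λ a _ x → let b , fab = total a x in b , Y⊆U (proj₂ (within _ fab)) , fab)
      , (λ a _ b _ c _ → functional a b c) )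
      , (λ a _ b _ c _ → injective a b c)

    -- Points related by `f` lie in `X` and `Y`, hence in `U`, so the bounded clauses already cover
    -- every point at which the unbounded ones say something.
    InjIn⇒Inj : ∀ {f} → InjIn U f X Y → Inj f X Y
    InjIn⇒Inj ((within , total , functional) , injective) =
      ( within
      , (λ a x → let b , _ , fab = total a (X⊆U x) x in b , fab)
      , (λ { a b c p@(fab , fac) → let x , y = within _ fab in
               functional a (X⊆U x) b (Y⊆U y) c (Y⊆U (proj₂ (within _ fac))) p }) )
      , (λ { a b c p@(fac , fbc) → let x , y = within _ fac in
               injective a (X⊆U x) b (X⊆U (proj₁ (within _ fbc))) c (Y⊆U y) p })

    properInj-bounded : ProperInj X Y → ProperInjIn U X Y
    properInj-bounded (f , inj , ¬onto) =
      f , Within⇒Power (proj₁ (proj₁ inj)) , Inj⇒InjIn {f} inj ,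
      λ onto → ¬onto λ b y → let a , _ , fab = onto b (Y⊆U y) y in a , fab

    properInj-unbounded : ProperInjIn U X Y → ProperInj X Y
    properInj-unbounded (f , _ , inj , ¬onto) =
      f , InjIn⇒Inj {f} inj ,
      λ onto → ¬onto λ b _ y → let a , fab = onto b y in
                               a , X⊆U (proj₁ (proj₁ (proj₁ inj) _ fab)) , fab

    ⋠-bounded : ¬ (X ≼ Y) → NoInjIn U X Y
    ⋠-bounded X⋠Y f _ inj = X⋠Y (f , InjIn⇒Inj {f} inj)

    ⋠-unbounded : NoInjIn U X Y → ¬ (X ≼ Y)
    ⋠-unbounded none (f , inj) = none f (Within⇒Power (proj₁ (proj₁ inj))) (Inj⇒InjIn {f} inj)

  ≺-cong-⇔ : ∀ {X X′ Y Y′} → X ≐ X′ → Y ≐ Y′ → (X ≺ Y → X′ ≺ Y′) × (X′ ≺ Y′ → X ≺ Y)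
  ≺-cong-⇔ {X} {X′} {Y} {Y′} X≐X′ Y≐Y′ =
    ≺-cong {X} {X′} {Y} {Y′} X≐X′ Y≐Y′ ,
    ≺-cong {X′} {X} {Y′} {Y} (≐-sym X≐X′) (≐-sym Y≐Y′)

  module _ {U F : Pred (Vec Carrier 1) ℓ} (F⊆U : F ⊆ U) (G : Pred (Vec Carrier 1) ℓ) where

    -- `G` is only ever tested at points of `F`, and these lie in `U`.
    ∩-restrict : (F ∩ G) ≐ (F ∩ (Power U ∩ G))
    ∩-restrict = (λ { {a ∷ []} (f , g) → f , F⊆U f ∷ [] , g }) , (λ { (f , _ , g) → f , g })

    ∖-restrict : (F ∖ G) ≐ (F ∖ (Power U ∩ G))
    ∖-restrict = (λ { (f , ¬g) → f , λ { (_ , g) → ¬g g } })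
               , (λ { {a ∷ []} (f , ¬g) → f , λ g → ¬g (F⊆U f ∷ [] , g) })

-- Cardinality in models of the theory

module Cardinality {ℓ} (em : ExcludedMiddle ℓ) (𝒜 : HenkinModel ℓ)
                   (M : IsModelOf 𝒜 Σ¹₁-CA₀ᶠⁱⁿ) where
  open HenkinModel 𝒜
  open Closures 𝒜
  open Injections 𝒜

  by-contradiction : ∀ {P : Set ℓ} → ¬ ¬ P → P
  by-contradiction = decidable-stable em

  -- For a concrete `φ` the implicit side condition reduces to the unit type and is filled in
  -- automatically, and the satisfaction of `weakenᶠ φ` reduces to a condition on `ρ` in which `R`
  -- does not occur.
  comprehend : ∀ {Γ} k {n} (φ : Formula Γ (suc k + n)) {_ : T (is-just (Σ¹₁? φ))} ρ v →
    ∃[ R ] ∀ as → (ext R as → Sat 𝒜 (weakenᶠ φ) (R ∷ ρ) (as Vec.++ v))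
                × (Sat 𝒜 (weakenᶠ φ) (R ∷ ρ) (as Vec.++ v) → ext R as)
  comprehend {Γ} k {n} φ {isΣ} ρ v
    with R , s ← close-elim (∃² k (∀¹* {n = n} (suc k) (R₀ ⟨ firstVars k n ⟩ ⇔̇ weakenᶠ φ)))
                            (M (comprehension {Γ} {k} {n} φ (to-witness-T (Σ¹₁? φ) isΣ))) ρ v
    = R , λ as → subst (λ bs → (ext R bs → Sat 𝒜 (weakenᶠ φ) (R ∷ ρ) (as Vec.++ v))
                             × (Sat 𝒜 (weakenᶠ φ) (R ∷ ρ) (as Vec.++ v) → ext R bs))
                       (lookup-firstVars k as v) (∀¹*-elim (suc k) {R₀ ⟨ firstVars k n ⟩ ⇔̇ weakenᶠ φ} s as)

  infix 4 _<_
  _<_ : Carrier → Carrier → Set ℓ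
  a < b = a ⪯ b × a ≢ b

  <⇒⋡ : ∀ {a b} → a < b → ¬ b ⪯ a
  <⇒⋡ (a⪯b , a≢b) b⪯a = a≢b (M ⪯-antisymmetric _ _ (a⪯b , b⪯a))

  compare : ∀ a b → a < b ⊎ a ≡ b ⊎ b < a
  compare a b with em {a ≡ b}
  ... | yes a≡b = inj₂ (inj₁ a≡b)
  ... | no  a≢b with M ⪯-linear a b
  ...   | inj₁ a⪯b = inj₁ (a⪯b , a≢b)
  ...   | inj₂ b⪯a = inj₂ (inj₂ (b⪯a , λ b≡a → a≢b (sym b≡a)))

  minimum : ∀ Z {a} → ext Z ∋ a → ∃[ m ] ext Z ∋ m × ∀ z → ext Z ∋ z → m ⪯ z
  minimum Z z = M ⪯-wellFounded Z (-, z)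

  -- The converse of `f`: surjectivity turns into totality, while injectivity and functionality
  -- change places. It is stated for partial injections because `extend` applies it to one with
  -- domain of totality `D`.
  inverse : ∀ {f D X Y} → PartialInj f D X Y → Onto f Y → Y ≼ X
  inverse {f} ((within , total , functional) , injective) onto
    with g , g≡ ← comprehend 1 (R₀ ⟨ 1F ∷ 0F ∷ [] ⟩) (f ∷ []) []
    = g , ( (λ { (a ∷ b ∷ []) gab →
                   let x , y = within (b ∷ a ∷ []) (proj₁ (g≡ (a ∷ b ∷ [])) gab) in y , x })
          , (λ a y → let b , fba = onto a y in b , proj₂ (g≡ (a ∷ b ∷ [])) fba)
          , (λ a b c (gab , gac) → injective b c a (proj₁ (g≡ (a ∷ b ∷ [])) gab , proj₁ (g≡ (a ∷ c ∷ [])) gac)) )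
        , (λ a b c (gac , gbc) → functional c a b (proj₁ (g≡ (a ∷ c ∷ [])) gac , proj₁ (g≡ (b ∷ c ∷ [])) gbc))

  -- Extending f by the identity gives an injection of the universe.
  selfInjection-onto : ∀ {f Z} → Inj f Z Z → Onto f Z
  selfInjection-onto {f} {Z} ((within , total , functional) , injective) z Zz =
    by-contradiction λ z∉f → proj₂ (proj₂ (M 𝕍-finite))
      (g , (((λ { (a ∷ b ∷ []) _ → V∋ a , V∋ b }) , (λ a _ → g-total a) , g-functional) , g-injective)
         , λ onto → z∉g z∉f (onto z (V∋ z)))
    where
    V = proj₁ (M 𝕍-finite)
    V∋ : ∀ a → ext V ∋ a
    V∋ a = proj₂ (proj₁ (proj₂ (M 𝕍-finite)) a) refl
    -- The complement of `Z` is expressed as the complement of the domain of `f`: `Z` is a mere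
    -- predicate, but `f` is available as a comprehension parameter.
    Graph : Carrier → Carrier → Set ℓ
    Graph a b = f [ a , b ] ⊎ (¬ (∃[ c ] f [ a , c ]) × a ≡ b)
    comprehended = comprehend 1
      (R₀ ⟨ 0F ∷ 1F ∷ [] ⟩ ∨̇ (¬̇ (∃¹ (R₀ ⟨ 1F ∷ 0F ∷ [] ⟩)) ∧̇ 0F ≈̇ 1F)) (f ∷ []) []
    g = proj₁ comprehended
    to : ∀ {a b} → g [ a , b ] → Graph a b
    to = proj₁ (proj₂ comprehended _)
    from : ∀ {a b} → Graph a b → g [ a , b ]
    from = proj₂ (proj₂ comprehended _)
    g-total : ∀ a → ∃[ b ] g [ a , b ]
    g-total a with em {∃[ c ] f [ a , c ]}
    ... | yes (c , fac) = c , from (inj₁ fac)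
    ... | no  ∄c        = a , from (inj₂ (∄c , refl))
    g-functional : ∀ a b c → g [ a , b ] × g [ a , c ] → b ≡ c
    g-functional a b c (gab , gac) with to gab | to gac
    ... | inj₁ fab         | inj₁ fac         = functional a b c (fab , fac)
    ... | inj₁ fab         | inj₂ (∄ , _)     = contradiction (b , fab) ∄
    ... | inj₂ (∄ , _)     | inj₁ fac         = contradiction (c , fac) ∄
    ... | inj₂ (_ , refl)  | inj₂ (_ , refl)  = refl
    -- Values of `f` lie in `Z`, where `f` is defined, so they never collide with the fixed points
    -- added outside the domain.
    value-in-domain : ∀ {a b} → f [ a , b ] → ∃[ c ] f [ b , c ]
    value-in-domain fab = total _ (proj₂ (within _ fab))
    g-injective : ∀ a b c → g [ a , c ] × g [ b , c ] → a ≡ b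
    g-injective a b c (gac , gbc) with to gac | to gbc
    ... | inj₁ fac        | inj₁ fbc        = injective a b c (fac , fbc)
    ... | inj₁ fac        | inj₂ (∄ , refl) = contradiction (value-in-domain fac) ∄
    ... | inj₂ (∄ , refl) | inj₁ fbc        = contradiction (value-in-domain fbc) ∄
    ... | inj₂ (_ , refl) | inj₂ (_ , refl) = refl
    z∉g : ¬ (∃[ a ] f [ a , z ]) → ¬ (∃[ a ] g [ a , z ])
    z∉g z∉f (a , gaz) with to gaz
    ... | inj₁ faz        = z∉f (a , faz)
    ... | inj₂ (∄ , refl) = ∄ (total z Zz)

  -- The last component allows surjectivity of the composite to be passed on to the second factor.
  compose : ∀ {f g X Y Z} → Inj f X Y → Inj g Y Z →
            ∃[ h ] Inj h X Z × (∀ {a c} → h [ a , c ] → ∃[ b ] f [ a , b ] × g [ b , c ])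
  compose {f} {g} ((f-within , f-total , f-functional) , f-injective)
                  ((g-within , g-total , g-functional) , g-injective)
    with h , h≡ ← comprehend 1 (∃¹ (R₀ ⟨ 1F ∷ 0F ∷ [] ⟩ ∧̇ R₁ ⟨ 0F ∷ 2F ∷ [] ⟩)) (f ∷ g ∷ []) []
    = h
    , ( ( (λ { (a ∷ c ∷ []) hac → let b , fab , gbc = to hac in
                 proj₁ (f-within _ fab) , proj₂ (g-within _ gbc) })
        , (λ a x → let b , fab = f-total a x
                       c , gbc = g-total b (proj₂ (f-within _ fab))
                   in c , proj₂ (h≡ (a ∷ c ∷ [])) (b , fab , gbc))
        , (λ a c c′ (hac , hac′) → functional (to hac) (to hac′)) )
      , (λ a a′ c (hac , ha′c) → injective (to hac) (to ha′c)) )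
    , to
    where
    to : ∀ {a c} → h [ a , c ] → ∃[ b ] f [ a , b ] × g [ b , c ]
    to = proj₁ (h≡ _)
    functional : ∀ {a c c′} → ∃[ b ] f [ a , b ] × g [ b , c ] → ∃[ b ] f [ a , b ] × g [ b , c′ ] → c ≡ c′
    functional (b , fab , gbc) (b′ , fab′ , gb′c′) with refl ← f-functional _ b b′ (fab , fab′) =
      g-functional _ _ _ (gbc , gb′c′)
    injective : ∀ {a a′ c} → ∃[ b ] f [ a , b ] × g [ b , c ] → ∃[ b ] f [ a′ , b ] × g [ b , c ] → a ≡ a′
    injective (b , fab , gbc) (b′ , fa′b′ , gb′c) with refl ← g-injective b b′ _ (gbc , gb′c) =
      f-injective _ _ _ (fab , fa′b′)

  -- If the given injection were onto, its inverse would embed `Y` into `X`.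
  ≺⇒properInj : ∀ {X Y} → X ≺ Y → ProperInj X Y
  ≺⇒properInj {X} {Y} ((f , inj) , Y⋠X) = f , inj , λ onto → Y⋠X (inverse {f} {X} {X} {Y} inj onto)

  properInj⇒≺ : ∀ {X Y} → ProperInj X Y → X ≺ Y
  properInj⇒≺ {X} {Y} (f , inj , ¬onto) = (f , inj) , λ (g , inj′) →
    let h , h-inj , h⊆ = compose {g} {f} {Y} {X} {Y} inj′ inj in
    ¬onto λ b y → let a , hab = selfInjection-onto {h} {Y} h-inj b y
                      c , _ , fcb = h⊆ hab
                  in c , fcb

  -- Without a maximum, the successor map would be an injection of Z into
  -- itself that misses the minimum of Z.
  maximum : ∀ Z {a} → ext Z ∋ a → ∃[ m ] ext Z ∋ m × ∀ z → ext Z ∋ z → z ⪯ m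
  maximum Z Za = by-contradiction λ no-max →
    let
      s , s≡ = comprehend 1
        ( R₀ ⟨ 0F ∷ [] ⟩ ∧̇ R₀ ⟨ 1F ∷ [] ⟩ ∧̇ 0F <̇ 1F
        ∧̇ ∀¹ (R₀ ⟨ 0F ∷ [] ⟩ ∧̇ 1F <̇ 0F ⇒̇ 2F ⪯̇ 0F)) (Z ∷ []) []
      to : ∀ {x y} → s [ x , y ] → Successor x y
      to = proj₁ (s≡ _)
      total : Total s (ext Z)
      total x Zx =
        -- This is where the lack of a maximum enters: a point of `Z` with nothing of `Z` above it
        -- would be one.
        let y , succ = successor x Zx (by-contradiction λ ∄z → no-max (x , Zx , below ∄z))
        in y , proj₂ (s≡ _) succ
      m , Zm , least = minimum Z Za
      x , sxm = selfInjection-onto {s} {ext Z}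
        ( ( (λ { (x ∷ y ∷ []) sxy → let Zx , Zy , _ = to sxy in Zx , Zy })
          , total
          , (λ x y z (sxy , sxz) → functional (to sxy) (to sxz)) )
        , (λ x y z (sxz , syz) → injective (to sxz) (to syz)) ) m Zm
      Zx , _ , x<m , _ = to sxm
    in <⇒⋡ x<m (least x Zx)
    where
    Successor : Carrier → Carrier → Set ℓ
    Successor x y = ext Z ∋ x × ext Z ∋ y × x < y × (∀ z → ext Z ∋ z × x < z → y ⪯ z)
    below : ∀ {x} → ¬ (∃[ z ] ext Z ∋ z × x < z) → ∀ z → ext Z ∋ z → z ⪯ x
    below {x} ∄z z Zz with compare z x
    ... | inj₁ (z⪯x , _)    = z⪯x
    ... | inj₂ (inj₁ refl)  = M ⪯-reflexive z
    ... | inj₂ (inj₂ x<z)   = contradiction (z , Zz , x<z) ∄z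
    successor : ∀ x → ext Z ∋ x → (∃[ z ] ext Z ∋ z × x < z) → ∃[ y ] Successor x y
    successor x Zx (z , Zz , x<z) =
      let
        W , W≡ = comprehend 0 (R₀ ⟨ 0F ∷ [] ⟩ ∧̇ 1F <̇ 0F) (Z ∷ []) (x ∷ [])
        y , Wy , least = minimum W (proj₂ (W≡ (z ∷ [])) (Zz , x<z))
        Zy , x<y = proj₁ (W≡ (y ∷ [])) Wy
      in y , Zx , Zy , x<y , λ w p → least w (proj₂ (W≡ (w ∷ [])) p)
    functional : ∀ {x y z} → Successor x y → Successor x z → y ≡ z
    functional (_ , Zy , x<y , y-least) (_ , Zz , x<z , z-least) =
      M ⪯-antisymmetric _ _ (y-least _ (Zz , x<z) , z-least _ (Zy , x<y))
    injective : ∀ {x y z} → Successor x z → Successor y z → x ≡ y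
    injective {x} {y} (Zx , _ , x<z , x-least) (Zy , _ , y<z , y-least) with compare x y
    ... | inj₁ x<y        = contradiction (x-least _ (Zy , x<y)) (<⇒⋡ y<z)
    ... | inj₂ (inj₁ x≡y) = x≡y
    ... | inj₂ (inj₂ y<x) = contradiction (y-least _ (Zx , y<x)) (<⇒⋡ x<z)

  -- A new pair is added only if `m` lies in `X` and has no value yet. Its value is a point of `Y`
  -- that `f` misses; one exists, since otherwise `inverse` would give `Y ≼ X`.
  extend : ∀ {f D X Y} → ¬ (Y ≼ X) → PartialInj f D X Y → ∀ m →
           ∃[ g ] PartialInj g (D ∪ (X ∩ (_≡ m ∷ []))) X Y
  extend {f} {D} {X} {Y} Y⋠X partial@((within , total , functional) , injective) m
    with em {∃[ c ] f [ m , c ]} | em {X ∋ m}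
  -- `PartialInj` makes `f` total on `D` without confining it to `D`, so `m` may already have a
  -- value.
  ... | yes mc | _ =
    f , (within , (λ { a (inj₁ d) → total a d ; a (inj₂ (_ , refl)) → mc }) , functional) , injective
  ... | no _ | no ∌m =
    f , (within , (λ { a (inj₁ d) → total a d ; a (inj₂ (x , refl)) → contradiction x ∌m }) , functional) , injective
  ... | no m∉f | yes Xm = g , (g-within , g-total , g-functional) , g-injective
    where
    unhit : ∃[ y ] (Y ∋ y × ¬ (∃[ a ] f [ a , y ]))
    unhit = by-contradiction λ ∄y →
      Y⋠X (inverse {f} {D} {X} {Y} partial λ b Yb → by-contradiction λ b∉f → ∄y (b , Yb , b∉f))
    y = proj₁ unhit
    Yy = proj₁ (proj₂ unhit)
    y∉f = proj₂ (proj₂ unhit)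
    Graph : Carrier → Carrier → Set ℓ
    Graph a b = f [ a , b ] ⊎ (a ≡ m × b ≡ y)
    comprehended = comprehend 1 (R₀ ⟨ 0F ∷ 1F ∷ [] ⟩ ∨̇ (0F ≈̇ 2F ∧̇ 1F ≈̇ 3F)) (f ∷ []) (m ∷ y ∷ [])
    g = proj₁ comprehended
    to : ∀ {a b} → g [ a , b ] → Graph a b
    to = proj₁ (proj₂ comprehended _)
    from : ∀ {a b} → Graph a b → g [ a , b ]
    from = proj₂ (proj₂ comprehended _)
    g-within : Within g X Y
    g-within (a ∷ b ∷ []) gab with to gab
    ... | inj₁ fab           = within _ fab
    ... | inj₂ (refl , refl) = Xm , Yy
    g-total : Total g (D ∪ (X ∩ (_≡ m ∷ [])))
    g-total a (inj₁ d)          = let b , fab = total a d in b , from (inj₁ fab)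
    g-total a (inj₂ (_ , refl)) = y , from (inj₂ (refl , refl))
    g-functional : ∀ a b c → g [ a , b ] × g [ a , c ] → b ≡ c
    g-functional a b c (gab , gac) with to gab | to gac
    ... | inj₁ fab        | inj₁ fac        = functional a b c (fab , fac)
    ... | inj₁ fab        | inj₂ (refl , _) = contradiction (b , fab) m∉f
    ... | inj₂ (refl , _) | inj₁ fac        = contradiction (c , fac) m∉f
    ... | inj₂ (_ , b≡y)  | inj₂ (_ , c≡y)  = trans b≡y (sym c≡y)
    g-injective : ∀ a b c → g [ a , c ] × g [ b , c ] → a ≡ b
    g-injective a b c (gac , gbc) with to gac | to gbc
    ... | inj₁ fac        | inj₁ fbc        = injective a b c (fac , fbc)
    ... | inj₁ fac        | inj₂ (_ , refl) = contradiction (a , fac) y∉f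
    ... | inj₂ (_ , refl) | inj₁ fbc        = contradiction (b , fbc) y∉f
    ... | inj₂ (a≡m , _)  | inj₂ (b≡m , _)  = trans a≡m (sym b≡m)

  -- Let m be the maximum of the set of points below which X can be embedded
  -- in Y: such an embedding extends to m, so m has no successor.
  comparable : ∀ X Y → ¬ (ext Y ≼ ext X) → ext X ≼ ext Y
  comparable X Y Y⋠X =
    let
      -- The condition on a point `a` unfolds to a `PartialInj` from `X` to `Y` that is total on the
      -- points of `X` strictly below `a`. The quantifier over injections makes this a genuinely
      -- second-order instance of Σ¹₁ comprehension.
      E , E≡ = comprehend 0
        (∃² binary
          ( ( R₀ ⊆̇ R₁ ×̇ R₂
            ∧̇ ∀¹ (R₁ ⟨ 0F ∷ [] ⟩ ∧̇ 0F <̇ 1F ⇒̇ ∃¹ (R₀ ⟨ 1F ∷ 0F ∷ [] ⟩))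
            ∧̇ ∀¹ (∀¹ (∀¹ (R₀ ⟨ 2F ∷ 1F ∷ [] ⟩ ∧̇ R₀ ⟨ 2F ∷ 0F ∷ [] ⟩ ⇒̇ 1F ≈̇ 0F))))
          ∧̇ ∀¹ (∀¹ (∀¹ (R₀ ⟨ 2F ∷ 0F ∷ [] ⟩ ∧̇ R₀ ⟨ 1F ∷ 0F ∷ [] ⟩ ⇒̇ 2F ≈̇ 1F)))))
        (X ∷ Y ∷ []) []
      V , V≡ , _ = M 𝕍-finite
      a₀ , _ , least = minimum V (proj₂ (V≡ nonempty) refl)
      ∅ , ∅≡ = comprehend 1 (¬̇ (0F ≈̇ 0F)) [] []
      -- Nothing lies strictly below the least point, so the empty relation is a witness.
      Ea₀ : ext E ∋ a₀
      Ea₀ = proj₂ (E≡ _)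
        ( ∅
        , ( (λ { as@(_ ∷ _ ∷ []) p → contradiction refl (proj₁ (∅≡ as) p) })
          , (λ a (_ , a<a₀) → contradiction (least a (proj₂ (V≡ a) refl)) (<⇒⋡ a<a₀))
          , (λ _ _ _ (p , _) → contradiction refl (proj₁ (∅≡ _) p)) )
        , (λ _ _ _ (p , _) → contradiction refl (proj₁ (∅≡ _) p)) )
      m , Em , greatest = maximum E Ea₀
      f , f-inj = proj₁ (E≡ (m ∷ [])) Em
      g , g-inj = extend {f} {ext X ∩ λ as → Vec.head as < m} {ext X} {ext Y} Y⋠X f-inj m
      E-successor : ∀ b → m < b → (∀ a → m < a → b ⪯ a) → ext E ∋ b
      E-successor b m<b b-least = proj₂ (E≡ (b ∷ []))
        ( g
        , PartialInj-mono {g} {Up-to m} {ext X ∩ λ as → Vec.head as < b} {ext X} {ext X} {ext Y} {ext Y}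
            (λ { {a ∷ []} (x , a<b) → below-successor b-least x a<b }) id id g-inj )
      ∄above : ¬ (∃[ a ] m < a)
      ∄above (a , m<a) =
        let
          W , W≡ = comprehend 0 (1F <̇ 0F) [] (m ∷ [])
          b , Wb , b-least = minimum W (proj₂ (W≡ (a ∷ [])) m<a)
          m<b = proj₁ (W≡ _) Wb
        in <⇒⋡ m<b (greatest b (E-successor b m<b λ c m<c → b-least c (proj₂ (W≡ _) m<c)))
    -- As nothing lies above `m`, all of `X` is contained in `Up-to m`, on which `g` is total.
    in g , PartialInj-mono {g} {Up-to m} {ext X} {ext X} {ext X} {ext Y} {ext Y}
             (λ { {a ∷ []} x → below-maximum ∄above x }) id id g-inj
    where
    Up-to : Carrier → Pred (Vec Carrier 1) ℓ
    Up-to m = (ext X ∩ λ as → Vec.head as < m) ∪ (ext X ∩ (_≡ m ∷ []))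
    below-successor : ∀ {m a b} → (∀ c → m < c → b ⪯ c) → ext X ∋ a → a < b → Up-to m ∋ a
    below-successor {m} {a} least x a<b with compare a m
    ... | inj₁ a<m         = inj₁ (x , a<m)
    ... | inj₂ (inj₁ refl) = inj₂ (x , refl)
    ... | inj₂ (inj₂ m<a)  = contradiction (least a m<a) (<⇒⋡ a<b)
    below-maximum : ∀ {m a} → ¬ (∃[ c ] m < c) → ext X ∋ a → Up-to m ∋ a
    below-maximum {m} {a} ∄c x with compare a m
    ... | inj₁ a<m         = inj₁ (x , a<m)
    ... | inj₂ (inj₁ refl) = inj₂ (x , refl)
    ... | inj₂ (inj₂ m<a)  = contradiction (a , m<a) ∄c

  -- Comparability supplies the missing half `X ≼ Y`; extensional equality carries it from members
  -- of `Rel 0` to the predicates.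
  ⋠⇒≺ : ∀ {X Y} → Definable X → Definable Y → ¬ (Y ≼ X) → X ≺ Y
  ⋠⇒≺ {X} {Y} (R , R≐X) (S , S≐Y) Y⋠X =
    ≼-cong {ext R} {X} {ext S} {Y} R≐X S≐Y
      (comparable R S λ S≼R → Y⋠X (≼-cong {ext S} {Y} {ext R} {X} S≐Y R≐X S≼R)) , Y⋠X

  ∩-definable : ∀ F G → Definable (ext F ∩ ext G)
  ∩-definable F G =
    let R , R≡ = comprehend 0 ((R₀ ∩̇ R₁) ⟨ 0F ∷ [] ⟩) (F ∷ G ∷ []) [] in
    R , (λ { {a ∷ []} → proj₁ (R≡ (a ∷ [])) }) , (λ { {a ∷ []} → proj₂ (R≡ (a ∷ [])) })

  ∖-definable : ∀ F G → Definable (ext F ∖ ext G)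
  ∖-definable F G =
    let R , R≡ = comprehend 0 ((R₀ ∖̇ R₁) ⟨ 0F ∷ [] ⟩) (F ∷ G ∷ []) [] in
    R , (λ { {a ∷ []} → proj₁ (R≡ (a ∷ [])) }) , (λ { {a ∷ []} → proj₂ (R≡ (a ∷ [])) })

  module _ {U X Y : Pred (Vec Carrier 1) ℓ} (X⊆U : X ⊆ U) (Y⊆U : Y ⊆ U) where

    -- Given as a pair of implications, since that is what the satisfaction of a formula built with
    -- `⇔̇` unfolds to.
    ≺⇔properInjIn : (X ≺ Y → ProperInjIn U X Y) × (ProperInjIn U X Y → X ≺ Y)
    ≺⇔properInjIn =
      (λ X≺Y → properInj-bounded {U} {X} {Y} X⊆U Y⊆U (≺⇒properInj {X} {Y} X≺Y)) ,
      (λ p → properInj⇒≺ {X} {Y} (properInj-unbounded {U} {X} {Y} X⊆U Y⊆U p))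

    ≺⇔noInjIn : Definable X → Definable Y → (X ≺ Y → NoInjIn U Y X) × (NoInjIn U Y X → X ≺ Y)
    ≺⇔noInjIn X-def Y-def =
      (λ (_ , Y⋠X) → ⋠-bounded {U} {Y} {X} Y⊆U X⊆U Y⋠X) ,
      (λ none → ⋠⇒≺ {X} {Y} X-def Y-def (⋠-unbounded {U} {Y} {X} Y⊆U X⊆U none))

-- Passing from a model to a larger one

map-injective : ∀ {a b} {A : Set a} {B : Set b} {f : A → B} → Injective _≡_ _≡_ f →
                ∀ {n} → Injective _≡_ _≡_ (Vec.map {n = n} f)
map-injective f-inj {x = []}     {[]}     _  = refl
map-injective f-inj {x = x ∷ xs} {y ∷ ys} eq =
  let fx≡fy , fxs≡fys = ∷-injective eq in cong₂ _∷_ (f-inj fx≡fy) (map-injective f-inj fxs≡fys)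

module Image {ℓ} {𝒜 ℬ : HenkinModel ℓ} (s : Substructure 𝒜 ℬ) where
  open Substructure s
  private
    module A where
      open HenkinModel 𝒜 public
      open Injections 𝒜 public
    module B where
      open HenkinModel ℬ public
      open Injections ℬ public

  image : ∀ {n} → Pred (Vec A.Carrier n) ℓ → Pred (Vec B.Carrier n) ℓ
  image X bs = ∃[ as ] X as × Vec.map ι as ≡ bs

  image-reflects : ∀ {n} {X : Pred (Vec A.Carrier n) ℓ} {as} → image X (Vec.map ι as) → X as
  image-reflects {X = X} (as , x , eq) = subst X (map-injective ι-injective eq) x

  -- Images respect intersections because `ι` is injective: by `image-reflects`, a tuple in both
  -- images comes from a single tuple in both relations.
  incl-∩ : ∀ F G → image (A.ext {0} F ∩ A.ext G) ≐ (B.ext (incl F) ∩ B.ext (incl G))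
  incl-∩ F G =
    (λ { (as , (Fa , Ga) , refl) → proj₂ (ext-incl F) (as , Fa , refl)
                                 , proj₂ (ext-incl G) (as , Ga , refl) }) ,
    (λ { (Fb , Gb) → meet (proj₁ (ext-incl F) Fb) (proj₁ (ext-incl G) Gb) })
    where
    meet : ∀ {bs} → image (A.ext F) bs → image (A.ext G) bs → image (A.ext F ∩ A.ext G) bs
    meet (as , Fa , refl) Gb = as , (Fa , image-reflects {X = A.ext G} Gb) , refl

  incl-∖ : ∀ F G → image (A.ext {0} F ∖ A.ext G) ≐ (B.ext (incl F) ∖ B.ext (incl G))
  incl-∖ F G =
    (λ { (as , (Fa , ¬Ga) , refl) →
           proj₂ (ext-incl F) (as , Fa , refl) ,
           λ Gb → ¬Ga (image-reflects {X = A.ext G} (proj₁ (ext-incl G) Gb)) }) ,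
    (λ { (Fb , ¬Gb) → minus (proj₁ (ext-incl F) Fb) λ Gb → ¬Gb (proj₂ (ext-incl G) Gb) })
    where
    minus : ∀ {bs} → image (A.ext F) bs → ¬ image (A.ext G) bs → image (A.ext F ∖ A.ext G) bs
    minus (as , Fa , refl) ¬Gb = as , (Fa , λ Ga → ¬Gb (as , Ga , refl)) , refl

  incl-intro : ∀ {f a b} → f A.[ a , b ] → incl f B.[ ι a , ι b ]
  incl-intro {f} fab = proj₂ (ext-incl f) (-, fab , refl)

  incl-elim : ∀ {f c d} → incl f B.[ c , d ] → ∃[ a ] ∃[ b ] f A.[ a , b ] × ι a ≡ c × ι b ≡ d
  incl-elim {f} p with proj₁ (ext-incl f) p
  ... | a ∷ b ∷ [] , fab , refl = a , b , fab , refl , refl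

  incl-Inj : ∀ {f X Y} → A.Inj f X Y → B.Inj (incl f) (image X) (image Y)
  incl-Inj {f} {X} {Y} ((within , total , functional) , injective) =
    (within′ , total′ , functional′) , injective′
    where
    within′ : B.Within (incl f) (image X) (image Y)
    within′ (c ∷ d ∷ []) fcd with a , b , fab , refl , refl ← incl-elim {f} fcd =
      let x , y = within _ fab in (-, x , refl) , (-, y , refl)
    total′ : B.Total (incl f) (image X)
    total′ c (a ∷ [] , x , refl) = let b , fab = total a x in ι b , incl-intro {f} fab
    functional′ : ∀ c d e → incl f B.[ c , d ] × incl f B.[ c , e ] → d ≡ e
    functional′ c d e (fcd , fce)
      with a , b , fab , refl , refl ← incl-elim {f} fcd
      with a′ , b′ , fa′b′ , ιa′≡ιa , refl ← incl-elim {f} fce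
      with refl ← ι-injective ιa′≡ιa = cong ι (functional a b b′ (fab , fa′b′))
    injective′ : ∀ c d e → incl f B.[ c , e ] × incl f B.[ d , e ] → c ≡ d
    injective′ c d e (fce , fde)
      with a , b , fab , refl , refl ← incl-elim {f} fce
      with a′ , b′ , fa′b′ , refl , ιb′≡ιb ← incl-elim {f} fde
      with refl ← ι-injective ιb′≡ιb = cong ι (injective a a′ b (fab , fa′b′))

  -- The image of a missed point is still missed: `incl f` contains only images of pairs of `f`, so
  -- a preimage of `ι b` would come from a preimage of `b`.
  incl-ProperInj : ∀ {X Y} → A.ProperInj X Y → B.ProperInj (image X) (image Y)
  incl-ProperInj {X} {Y} (f , inj , ¬onto) =
    incl f , incl-Inj {f} {X} {Y} inj , λ onto → ¬onto λ b y →
      let c , fcb = onto (ι b) (-, y , refl)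
          a , b′ , fab′ , _ , ιb′≡ιb = incl-elim {f} fcb
      in a , subst (λ d → f A.[ a , d ]) (ι-injective ιb′≡ιb) fab′

  -- Going up, an injection of `Y′` into `X′` might newly appear in `ℬ`; finiteness of `ℬ` excludes
  -- it through `properInj⇒≺`. Going down, an injection of `X′` into `Y′` need not come from `𝒜`;
  -- comparability inside `𝒜` provides one.
  ≺-invariant : ExcludedMiddle ℓ → IsModelOf 𝒜 Σ¹₁-CA₀ᶠⁱⁿ → IsModelOf ℬ Σ¹₁-CA₀ᶠⁱⁿ →
    ∀ {X Y X′ Y′} → A.Definable X → A.Definable Y → image X ≐ X′ → image Y ≐ Y′ →
    (X A.≺ Y) ⇔ (X′ B.≺ Y′)
  ≺-invariant em MA MB {X} {Y} {X′} {Y′} X-def Y-def X≐X′ Y≐Y′ = mk⇔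
    (λ X≺Y → B.≺-cong {image X} {X′} {image Y} {Y′} X≐X′ Y≐Y′
      (CB.properInj⇒≺ {image X} {image Y} (incl-ProperInj {X} {Y} (CA.≺⇒properInj {X} {Y} X≺Y))))
    (λ X′≺Y′ → CA.⋠⇒≺ {X} {Y} X-def Y-def λ (f , inj) →
      proj₂ X′≺Y′ (B.≼-cong {image Y} {Y′} {image X} {X′} Y≐Y′ X≐X′ (incl f , incl-Inj {f} {Y} {X} inj)))
    where
    module CA = Cardinality em 𝒜 MA
    module CB = Cardinality em ℬ MB

-- The quantifiers `Most` and `More-than`

-- The unbounded Σ¹₁ and Π¹₁ definitions; after `bound`, their satisfaction unfolds to `ProperInjIn`
-- and `NoInjIn`.
properInjᶠ noInjᶠ : ∀ {Γ} → RTerm Γ 1 → RTerm Γ 1 → Formula Γ 0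
properInjᶠ X Y =
  ∃² binary (IsInjection R₀ (weakenᵗ X) (weakenᵗ Y) ∧̇ ¬̇ IsOnto R₀ (weakenᵗ Y))
noInjᶠ X Y = ∀² binary (¬̇ IsInjection R₀ (weakenᵗ X) (weakenᵗ Y))

module _ {ℓ} (em : ExcludedMiddle ℓ) where

  most-definable : BoundedΔ¹₁Definable ℓ Σ¹₁-CA₀ᶠⁱⁿ (unary ∷ []) (unary ∷ []) Most
  most-definable = record
    { Φ         = Φ
    ; Ψ         = Ψ
    ; Φ-Σ¹₁     = to-witness-T (Σ¹₁? Φ) _
    ; Ψ-Π¹₁     = all² (matrix (to-witness-T (firstOrder? _) _))
    -- The relations arrive in reverse order because `close²` binds the last variable of the context
    -- outermost.
    ; Φ-defines = λ 𝒜 M G F → MostIn.properInj-defines 𝒜 M F G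
    ; Ψ-defines = λ 𝒜 M G F → MostIn.noInj-defines 𝒜 M F G
    }
    where
    Φ = properInjᶠ (R₀ ∖̇ R₁) (R₀ ∩̇ R₁)
    Ψ = noInjᶠ (R₀ ∩̇ R₁) (R₀ ∖̇ R₁)
    module MostIn (𝒜 : HenkinModel ℓ) (M : IsModelOf 𝒜 Σ¹₁-CA₀ᶠⁱⁿ) (F G : HenkinModel.Rel 𝒜 0) where
      open HenkinModel 𝒜 using (Carrier; ext)
      open Cardinality em 𝒜 M
      U X Y : Pred (Vec Carrier 1) ℓ
      -- Kept as the denotation of `𝒰` instead of `ext F`, so that the bounded formulas match by
      -- computation.
      U = ⟦_⟧ 𝒜 (fld R₀) (F ∷ G ∷ [])
      X = ext F ∖ ext G
      Y = ext F ∩ ext G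
      X⊆U : X ⊆ U
      X⊆U (f , _) = proj₂ (fld-unary 𝒜 R₀ (F ∷ G ∷ [])) f
      Y⊆U : Y ⊆ U
      Y⊆U (f , _) = proj₂ (fld-unary 𝒜 R₀ (F ∷ G ∷ [])) f
      properInj-defines = ≺⇔properInjIn {U} {X} {Y} X⊆U Y⊆U
      noInj-defines     = ≺⇔noInjIn {U} {X} {Y} X⊆U Y⊆U (∖-definable F G) (∩-definable F G)

  more-than-definable : BoundedΔ¹₁Definable ℓ Σ¹₁-CA₀ᶠⁱⁿ (unary ∷ unary ∷ []) (unary ∷ []) More-than
  more-than-definable = record
    { Φ         = Φ
    ; Ψ         = Ψ
    ; Φ-Σ¹₁     = to-witness-T (Σ¹₁? Φ) _
    ; Ψ-Π¹₁     = all² (matrix (to-witness-T (firstOrder? _) _))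
    ; Φ-defines = λ 𝒜 M H G F → More-thanIn.properInj-defines 𝒜 M F G H
    ; Ψ-defines = λ 𝒜 M H G F → More-thanIn.noInj-defines 𝒜 M F G H
    }
    where
    Φ = properInjᶠ (R₁ ∩̇ R₂) (R₀ ∩̇ R₂)
    Ψ = noInjᶠ (R₀ ∩̇ R₂) (R₁ ∩̇ R₂)
    module More-thanIn (𝒜 : HenkinModel ℓ) (M : IsModelOf 𝒜 Σ¹₁-CA₀ᶠⁱⁿ) (F G H : HenkinModel.Rel 𝒜 0) where
      open HenkinModel 𝒜 using (Carrier; ext)
      open Cardinality em 𝒜 M
      U X Y : Pred (Vec Carrier 1) ℓ
      U = ⟦_⟧ 𝒜 (fld R₀ ∪̇ fld R₁) (F ∷ G ∷ H ∷ [])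
      X = ext G ∩ ext H
      Y = ext F ∩ ext H
      X⊆U : X ⊆ U
      X⊆U (g , _) = inj₂ (proj₂ (fld-unary 𝒜 R₁ (F ∷ G ∷ H ∷ [])) g)
      Y⊆U : Y ⊆ U
      Y⊆U (f , _) = inj₁ (proj₂ (fld-unary 𝒜 R₀ (F ∷ G ∷ H ∷ [])) f)
      properInj-defines = ≺⇔properInjIn {U} {X} {Y} X⊆U Y⊆U
      noInj-defines     = ≺⇔noInjIn {U} {X} {Y} X⊆U Y⊆U (∩-definable G H) (∩-definable F H)

  most-domainIndependent :
    HenkinDomainIndependent ℓ Σ¹₁-CA₀ᶠⁱⁿ (unary ∷ []) (unary ∷ []) Most
  most-domainIndependent 𝒜 ℬ MA MB s (F ∷ G ∷ []) =
    ≺-invariant em MA MB (∖-definable F G) (∩-definable F G) (incl-∖ F G) (incl-∩ F G)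
    where
    open Cardinality em 𝒜 MA using (∖-definable; ∩-definable)
    open Image s

  more-than-domainIndependent :
    HenkinDomainIndependent ℓ Σ¹₁-CA₀ᶠⁱⁿ (unary ∷ unary ∷ []) (unary ∷ []) More-than
  more-than-domainIndependent 𝒜 ℬ MA MB s (F ∷ G ∷ H ∷ []) =
    ≺-invariant em MA MB (∩-definable G H) (∩-definable F H) (incl-∩ G H) (incl-∩ F H)
    where
    open Cardinality em 𝒜 MA using (∩-definable)
    open Image s

-- `Power U` is the denotation of `𝒰` raised by `^̇ 0` in `cutDown`; both compared sets keep their
-- elements when `G` is cut down to it.
most-conservative : ∀ {ℓ} → HenkinConservative ℓ Σ¹₁-CA₀ᶠⁱⁿ (unary ∷ []) (unary ∷ []) Most
most-conservative {ℓ} 𝒜 M G F =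
  ≺-cong-⇔ {ext F ∖ ext G} {ext F ∖ (Power U ∩ ext G)} {ext F ∩ ext G} {ext F ∩ (Power U ∩ ext G)}
    (∖-restrict {U} {ext F} F⊆U (ext G)) (∩-restrict {U} {ext F} F⊆U (ext G))
  where
  open HenkinModel 𝒜
  open Injections 𝒜
  U : Pred (Vec Carrier 1) ℓ
  U = ⟦_⟧ 𝒜 (fld R₀) (F ∷ G ∷ [])
  F⊆U : ext F ⊆ U
  F⊆U = proj₂ (fld-unary 𝒜 R₀ (F ∷ G ∷ []))

more-than-conservative : ∀ {ℓ} →
  HenkinConservative ℓ Σ¹₁-CA₀ᶠⁱⁿ (unary ∷ unary ∷ []) (unary ∷ []) More-than
more-than-conservative {ℓ} 𝒜 M H G F =
  ≺-cong-⇔ {ext G ∩ ext H} {ext G ∩ (Power U ∩ ext H)} {ext F ∩ ext H} {ext F ∩ (Power U ∩ ext H)}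
    (∩-restrict {U} {ext G} G⊆U (ext H)) (∩-restrict {U} {ext F} F⊆U (ext H))
  where
  open HenkinModel 𝒜
  open Injections 𝒜
  U : Pred (Vec Carrier 1) ℓ
  U = ⟦_⟧ 𝒜 (fld R₀ ∪̇ fld R₁) (F ∷ G ∷ H ∷ [])
  F⊆U : ext F ⊆ U
  F⊆U f = inj₁ (proj₂ (fld-unary 𝒜 R₀ (F ∷ G ∷ H ∷ [])) f)
  G⊆U : ext G ⊆ U
  G⊆U g = inj₂ (proj₂ (fld-unary 𝒜 R₁ (F ∷ G ∷ H ∷ [])) g)

theorem12p1 : ∀ {ℓ} → ExcludedMiddle ℓ →
    ( BoundedΔ¹₁Definable ℓ Σ¹₁-CA₀ᶠⁱⁿ (unary ∷ []) (unary ∷ []) Most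
    × BoundedΔ¹₁Definable ℓ Σ¹₁-CA₀ᶠⁱⁿ (unary ∷ unary ∷ []) (unary ∷ []) More-than )
    ×
    ( ( HenkinDomainIndependent ℓ Σ¹₁-CA₀ᶠⁱⁿ (unary ∷ []) (unary ∷ []) Most
      × HenkinDomainIndependent ℓ Σ¹₁-CA₀ᶠⁱⁿ (unary ∷ unary ∷ []) (unary ∷ []) More-than )
    × ( HenkinConservative ℓ Σ¹₁-CA₀ᶠⁱⁿ (unary ∷ []) (unary ∷ []) Most
      × HenkinConservative ℓ Σ¹₁-CA₀ᶠⁱⁿ (unary ∷ unary ∷ []) (unary ∷ []) More-than ) )
theorem12p1 em =
  (most-definable em , more-than-definable em) ,
  (most-domainIndependent em , more-than-domainIndependent em) ,
  (most-conservative , more-than-conservative)
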